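{- Let $G=(V,E)$ be a hypergraph and let $(U,\overline U)$ be a minimal balanced minimum $k$-partition split in $G$ for some integer $k\ge2$. Then for every vertex $u_0\in U$ there exist subsets $S\subseteq U\setminus\{u_0\}$ and $T\subseteq\overline U$ with $|S|\le 2k-3$ and $|T|\le 2k-2$ such that $(U,\overline U)$ is the source minimal minimum $(S\cup\{u_0\},T)$-terminal cut in $G$.
   Context: A hypergraph $G=(V,E)$ has finite vertex set $V$ and finite multiset $E$ of unit-cost hyperedges (subsets of $V$). For $X\subseteq V$, $\overline X=V\setminus X$ and $d(X)$ is the number of hyperedges meeting both $X$ and $\overline X$. The cost of an (ordered) partition of $V$ into non-empty parts is the number of hyperedges meeting at least two parts; a minimum $k$-partition is a $k$-partition of minimum cost. A 2-partition $(U,\overline U)$ is a balanced minimum $k$-partition split if there is a minimum $k$-partition $(V_1,\dots,V_k)$ with $U=\bigcup_{i=1}^{\lfloor k/2\rfloor}V_i$; it is minimal if there is no balanced minimum $k$-partition split $(U',\overline{U'})$ with $U'\subsetneq U$. For disjoint $S,T\subseteq V$, a 2-partition $(X,\overline X)$ is an $(S,T)$-terminal cut if $S\subseteq X\subseteq V\setminus T$; it is minimum if $d(X)$ is minimum among such cuts; the source minimal minimum $(S,T)$-terminal cut is the unique minimum one whose source set $X$ is inclusion-wise minimal. -}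

module Defs where

open import Data.Fin using (Fin)
open import Data.Fin.Properties using (any?) renaming (_≟_ to _≟ᶠ_)
open import Data.Fin.Subset using (Subset; _∈_; _⊆_; _⊂_; _∩_; ∁; ⋃; Nonempty; Empty)
open import Data.Fin.Subset.Properties using (nonempty?)
open import Data.List using (List; length; filter; take; tabulate)
open import Data.Nat using (ℕ; _≤_; ⌊_/2⌋)
open import Data.Product using (∃-syntax; _×_)
open import Relation.Binary.PropositionalEquality using (_≡_; _≢_)
open import Relation.Nullary using (¬_; Dec)
open import Relation.Nullary.Decidable using (_×-dec_; ¬?)

-- The hyperedge multiset is a list; nothing below depends on its order.
record Hypergraph : Set where
  field
    order : ℕ
    edges : List (Subset order)

  Vertex : Set
  Vertex = Fin order

  VertexSet : Set
  VertexSet = Subset order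

module _ {n : ℕ} where

  Meets : Subset n → Subset n → Set
  Meets e X = Nonempty (e ∩ X)

  meets? : (e X : Subset n) → Dec (Meets e X)
  meets? e X = nonempty? (e ∩ X)

  Crosses : Subset n → Subset n → Set
  Crosses X e = Meets e X × Meets e (∁ X)

  crosses? : (X e : Subset n) → Dec (Crosses X e)
  crosses? X e = meets? e X ×-dec meets? e (∁ X)

  MeetsTwoParts : {k : ℕ} → (Fin k → Subset n) → Subset n → Set
  MeetsTwoParts P e = ∃[ i ] ∃[ j ] (i ≢ j × Meets e (P i) × Meets e (P j))

  meetsTwoParts? : {k : ℕ} (P : Fin k → Subset n) (e : Subset n) → Dec (MeetsTwoParts P e)
  meetsTwoParts? P e =
    any? λ i → any? λ j → ¬? (i ≟ᶠ j) ×-dec (meets? e (P i) ×-dec meets? e (P j))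

  record IsPartition {k : ℕ} (P : Fin k → Subset n) : Set where
    field
      nonempty : ∀ i → Nonempty (P i)
      disjoint : ∀ i j → i ≢ j → Empty (P i ∩ P j)
      covers   : ∀ v → ∃[ i ] v ∈ P i

  -- (X , V ∖ X) is a partition into two non-empty parts; a 2-partition is
  -- represented throughout by its first part.
  Is2Partition : Subset n → Set
  Is2Partition X = Nonempty X × Nonempty (∁ X)

module _ (G : Hypergraph) where
  open Hypergraph G

  d : VertexSet → ℕ
  d X = length (filter (crosses? X) edges)

  cost : {k : ℕ} → (Fin k → VertexSet) → ℕ
  cost P = length (filter (meetsTwoParts? P) edges)

  record IsMinimumPartition {k : ℕ} (P : Fin k → VertexSet) : Set where
    field
      isPartition : IsPartition P
      minimum     : (Q : Fin k → VertexSet) → IsPartition Q → cost P ≤ cost Q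

  record IsBalancedSplit (k : ℕ) (U : VertexSet) : Set where
    field
      is2Partition : Is2Partition U
      parts        : Fin k → VertexSet
      isMinimum    : IsMinimumPartition parts
      union        : U ≡ ⋃ (take ⌊ k /2⌋ (tabulate parts))

  record IsMinimalBalancedSplit (k : ℕ) (U : VertexSet) : Set where
    field
      isBalancedSplit : IsBalancedSplit k U
      minimal         : ¬ (∃[ U′ ] (IsBalancedSplit k U′ × U′ ⊂ U))

  -- Disjointness of S and T follows from the existence of such an X.
  record IsTerminalCut (S T X : VertexSet) : Set where
    field
      is2Partition : Is2Partition X
      source       : S ⊆ X
      sink         : X ⊆ ∁ T

  record IsMinimumTerminalCut (S T X : VertexSet) : Set where
    field
      isTerminalCut : IsTerminalCut S T X
      minimum       : ∀ Y → IsTerminalCut S T Y → d X ≤ d Y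

  record IsInclusionMinimalMinimumTerminalCut (S T X : VertexSet) : Set where
    field
      isMinimum : IsMinimumTerminalCut S T X
      minimal   : ¬ (∃[ Y ] (IsMinimumTerminalCut S T Y × Y ⊂ X))

  -- Uniqueness is part of the definition ("the source minimal minimum cut").
  -- It is automatic when S and T are non-empty, by submodularity of d, but
  -- can fail when S or T is empty.
  record IsSourceMinimalMinimumTerminalCut (S T X : VertexSet) : Set where
    field
      isInclusionMinimal : IsInclusionMinimalMinimumTerminalCut S T X
      unique : ∀ Y → IsInclusionMinimalMinimumTerminalCut S T Y → Y ≡ X

{-# OPTIONS --safe #-}

-- By submodularity it suffices to find a small S such that d X > d U whenever
-- S ∪ {u₀} ⊆ X ⊊ U, and a small T such that d X ≥ d U whenever U ⊆ X ⊆ V ∖ T.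
-- Up to adding r to T, both are smallest transversals of the sets A ⊋ B that avoid r and
-- have d A < N (B = V ∖ U, r = u₀, N = d U + 1 for S; B = U, r ∈ V ∖ U, N = d U for T).
-- If such a transversal has 2k − 2 elements, each element uᵢ lies in a set Aᵢ of the
-- family that avoids the others, and Aᵢ can be taken of minimum d.  Let W be the set
-- of vertices in at least two of the Aᵢ, Z of those in none and Yᵢ of those in Aᵢ
-- only.  Adding the Aᵢ one at a time and uncrossing, the number of hyperedges meeting
-- two of the parts W, Z, Yᵢ plus the number meeting two Yᵢ or both W and Z stays at
-- most 2(N − 1).  Keeping either half of the Yᵢ as parts and merging everything else
-- gives two k-partitions whose costs add up to at most this number, so one of them
-- costs less than N.  As B ∪ {r} lies in its last part, this contradicts the
-- minimality of U (for S) or of the minimum k-partition (for T).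

module Submission where

open import Defs
open import Data.Fin.Subset using (_∈_; _⊆_; _∪_; _-_; ∁; ⁅_⁆; ∣_∣)
open import Data.Nat using (ℕ; _≤_; _*_; _∸_)
open import Data.Product using (∃-syntax; _×_)

open import Algebra.Properties.CommutativeSemigroup using (interchange)
open import Data.Bool using (Bool; true; false)
open import Data.Bool.Properties using (¬-not) renaming (_≟_ to _≟ᵇ_)
open import Data.Empty using (⊥-elim)
open import Data.Fin using (Fin; zero; suc; toℕ; fromℕ; fromℕ<; inject₁; splitAt; _↑ˡ_; _↑ʳ_)
open import Data.Fin.Properties using (any?; splitAt-↑ˡ; splitAt-↑ʳ; splitAt⁻¹-↑ˡ; splitAt⁻¹-↑ʳ; suc-injective; toℕ-fromℕ) renaming (_≟_ to _≟ᶠ_)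
open import Data.Fin.Relation.Unary.Top using (view; ‵fromℕ; ‵inject₁)
open import Data.Fin.Subset using (Subset; Nonempty; Empty; inside; outside; _∉_; _⊂_; _∩_; ⋃)
open import Data.Fin.Subset.Properties
open import Data.List using (List; []; _∷_; length; filter; map; take; tabulate)
open import Data.Nat.ListAction using (sum)
open import Data.Nat using (zero; suc; _+_; _<_; z≤n; s≤s; s≤s⁻¹; ⌊_/2⌋; _≤?_; _<?_)
open import Data.Nat.Properties hiding (suc-injective)
open import Data.Product using (Σ; ∃; _,_; proj₁; proj₂)
open import Data.Sum using (_⊎_; inj₁; inj₂; [_,_]′)
open import Data.Vec using (lookup; []; _∷_; here; there) renaming (tabulate to tabulateᵛ)
open import Data.Vec.Properties using ([]=⇒lookup; lookup⇒[]=; lookup∘tabulate)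
open import Function using (_∘_; const)
open import Relation.Binary.PropositionalEquality
open import Relation.Nullary using (¬_; Dec; yes; no; does; contradiction)
open import Relation.Nullary.Decidable using (_×-dec_; ¬?; dec-true; decidable-stable)
open import Relation.Unary using (Pred; Decidable)

-- Counting

⟦_⟧ : {P : Set} → Dec P → ℕ
⟦ yes _ ⟧ = 1
⟦ no  _ ⟧ = 0

⟦⟧≤1 : {P : Set} (P? : Dec P) → ⟦ P? ⟧ ≤ 1
⟦⟧≤1 (yes _) = ≤-refl
⟦⟧≤1 (no  _) = z≤n

⟦⟧-mono : {P Q : Set} (P? : Dec P) (Q? : Dec Q) → (P → Q) → ⟦ P? ⟧ ≤ ⟦ Q? ⟧
⟦⟧-mono (yes p) (yes _) f = ≤-refl
⟦⟧-mono (yes p) (no ¬q) f = contradiction (f p) ¬q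
⟦⟧-mono (no _)  _       f = z≤n

-- A left total of 1 forces at least 1 on the right, and a left total of 2 forces 2. Applied to one
-- hyperedge at a time, this yields both submodularity of `d` and the division of the weight between
-- two colourings.
⟦⟧-+-mono : {P Q R T : Set} (P? : Dec P) (Q? : Dec Q) (R? : Dec R) (T? : Dec T) →
  (P → R ⊎ T) → (Q → R ⊎ T) → (P → Q → R × T) → ⟦ P? ⟧ + ⟦ Q? ⟧ ≤ ⟦ R? ⟧ + ⟦ T? ⟧
⟦⟧-+-mono P?      Q?      (yes _) (yes _) f g h = +-mono-≤ (⟦⟧≤1 P?) (⟦⟧≤1 Q?)
⟦⟧-+-mono (yes p) (yes q) (yes _) (no ¬t) f g h = contradiction (proj₂ (h p q)) ¬t
⟦⟧-+-mono (yes p) (yes q) (no ¬r) T?      f g h = contradiction (proj₁ (h p q)) ¬r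
⟦⟧-+-mono (yes p) (no _)  (yes _) (no _)  f g h = ≤-refl
⟦⟧-+-mono (yes p) (no _)  (no ¬r) (yes _) f g h = ≤-refl
⟦⟧-+-mono (yes p) (no _)  (no ¬r) (no ¬t) f g h = ⊥-elim ([ ¬r , ¬t ]′ (f p))
⟦⟧-+-mono (no _)  (yes q) (yes _) (no _)  f g h = ≤-refl
⟦⟧-+-mono (no _)  (yes q) (no ¬r) (yes _) f g h = ≤-refl
⟦⟧-+-mono (no _)  (yes q) (no ¬r) (no ¬t) f g h = ⊥-elim ([ ¬r , ¬t ]′ (g q))
⟦⟧-+-mono (no _)  (no _)  R?      T?      f g h = z≤n

⟦⟧≥1 : {P : Set} (P? : Dec P) → P → 1 ≤ ⟦ P? ⟧
⟦⟧≥1 (yes _) _ = ≤-refl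
⟦⟧≥1 (no ¬p) p = contradiction p ¬p

module _ {P₁ P₂ Q : Set} (P₁? : Dec P₁) (P₂? : Dec P₂) (Q? : Dec Q) (P₂⇒P₁ : P₂ → P₁) where

  private
    ≥1 : P₁ ⊎ Q → 1 ≤ ⟦ P₁? ⟧ + ⟦ P₂? ⟧ + ⟦ Q? ⟧
    ≥1 (inj₁ p₁) = +-mono-≤ (+-mono-≤ (⟦⟧≥1 P₁? p₁) z≤n) z≤n
    ≥1 (inj₂ q)  = +-mono-≤ (z≤n {⟦ P₁? ⟧ + ⟦ P₂? ⟧}) (⟦⟧≥1 Q? q)

    ≥2 : P₂ ⊎ (P₁ × Q) → 2 ≤ ⟦ P₁? ⟧ + ⟦ P₂? ⟧ + ⟦ Q? ⟧
    ≥2 (inj₁ p₂)       = +-mono-≤ (+-mono-≤ (⟦⟧≥1 P₁? (P₂⇒P₁ p₂)) (⟦⟧≥1 P₂? p₂)) z≤n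
    ≥2 (inj₂ (p₁ , q)) = +-mono-≤ (+-mono-≤ (⟦⟧≥1 P₁? p₁) (z≤n {⟦ P₂? ⟧})) (⟦⟧≥1 Q? q)

    ≥3 : P₂ × Q → 3 ≤ ⟦ P₁? ⟧ + ⟦ P₂? ⟧ + ⟦ Q? ⟧
    ≥3 (p₂ , q) = +-mono-≤ (+-mono-≤ (⟦⟧≥1 P₁? (P₂⇒P₁ p₂)) (⟦⟧≥1 P₂? p₂)) (⟦⟧≥1 Q? q)

  -- Since `P₂` implies `P₁`, the right-hand side is at least 1, 2 or 3 exactly when `P₁ ⊎ Q`,
  -- `P₂ ⊎ (P₁ × Q)` or `P₂ × Q` holds. The five implications match each value of the left-hand side
  -- with the level it needs.
  ⟦⟧-uncross : {P₁′ P₂′ Q′ : Set} (P₁′? : Dec P₁′) (P₂′? : Dec P₂′) (Q′? : Dec Q′) →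
    (P₁′ → P₁ ⊎ Q) → (Q′ → P₁ ⊎ Q) → (P₂′ → P₂ ⊎ (P₁ × Q)) →
    (P₁′ → Q′ → P₂ ⊎ (P₁ × Q)) → (P₂′ → Q′ → P₂ × Q) →
    ⟦ P₁′? ⟧ + ⟦ P₂′? ⟧ + ⟦ Q′? ⟧ ≤ ⟦ P₁? ⟧ + ⟦ P₂? ⟧ + ⟦ Q? ⟧
  ⟦⟧-uncross P₁′?     (yes p₂) (yes q) _ _ _ _ h = ≤-trans (+-monoˡ-≤ 1 (+-monoˡ-≤ 1 (⟦⟧≤1 P₁′?))) (≥3 (h p₂ q))
  ⟦⟧-uncross P₁′?     (yes p₂) (no _)  _ _ h _ _ = ≤-trans (+-monoˡ-≤ 0 (+-monoˡ-≤ 1 (⟦⟧≤1 P₁′?))) (≥2 (h p₂))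
  ⟦⟧-uncross (yes p₁) (no _)   (yes q) _ _ _ h _ = ≥2 (h p₁ q)
  ⟦⟧-uncross (yes p₁) (no _)   (no _)  h _ _ _ _ = ≥1 (h p₁)
  ⟦⟧-uncross (no _)   (no _)   (yes q) _ h _ _ _ = ≥1 (h q)
  ⟦⟧-uncross (no _)   (no _)   (no _)  _ _ _ _ _ = z≤n

module _ {A : Set} where

  total : (A → ℕ) → List A → ℕ
  total w xs = sum (map w xs)

  total-mono : {w w′ : A → ℕ} → (∀ x → w x ≤ w′ x) → ∀ xs → total w xs ≤ total w′ xs
  total-mono w≤w′ []       = z≤n
  total-mono w≤w′ (x ∷ xs) = +-mono-≤ (w≤w′ x) (total-mono w≤w′ xs)

  total-+ : (w w′ : A → ℕ) → ∀ xs → total (λ x → w x + w′ x) xs ≡ total w xs + total w′ xs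
  total-+ w w′ []       = refl
  total-+ w w′ (x ∷ xs) rewrite total-+ w w′ xs = interchange +-commutativeSemigroup (w x) (w′ x) (total w xs) (total w′ xs)

  total-0 : ∀ xs → total (const 0) xs ≡ 0
  total-0 []       = refl
  total-0 (x ∷ xs) = total-0 xs

  length-filter≡total : {P : Pred A _} (P? : Decidable P) → ∀ xs → length (filter P? xs) ≡ total (λ x → ⟦ P? x ⟧) xs
  length-filter≡total P? []       = refl
  length-filter≡total P? (x ∷ xs) with P? x
  ... | yes _ = cong suc (length-filter≡total P? xs)
  ... | no  _ = length-filter≡total P? xs

-- Separating pairs in a hyperedge

module _ {n : ℕ} where

  HasPair : (Fin n → Fin n → Set) → Subset n → Set
  HasPair R e = ∃[ u ] ∃[ v ] (u ∈ e × v ∈ e × R u v)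

  hasPair? : {R : Fin n → Fin n → Set} → (∀ u v → Dec (R u v)) → ∀ e → Dec (HasPair R e)
  hasPair? R? e = any? λ u → any? λ v → u ∈? e ×-dec (v ∈? e ×-dec R? u v)

  ∈⇒inside : {X : Subset n} {v : Fin n} → v ∈ X → lookup X v ≡ inside
  ∈⇒inside = []=⇒lookup

  inside⇒∈ : {X : Subset n} {v : Fin n} → lookup X v ≡ inside → v ∈ X
  inside⇒∈ {X} {v} = lookup⇒[]= v X

  ∉⇒outside : {X : Subset n} {v : Fin n} → v ∉ X → lookup X v ≡ outside
  ∉⇒outside v∉X = ¬-not (v∉X ∘ inside⇒∈)

  -- Unlike `Crosses`, this form is symmetric in the two vertices, so a pair need not be oriented
  -- when only a difference in membership is known.
  Splits : Subset n → Subset n → Set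
  Splits X = HasPair λ u v → lookup X u ≢ lookup X v

  crosses⁻ : {X e : Subset n} → Crosses X e → ∃[ u ] ∃[ v ] (u ∈ e × v ∈ e × u ∈ X × v ∉ X)
  crosses⁻ {X} {e} ((u , u∈) , (v , v∈)) =
    let u∈e , u∈X = x∈p∩q⁻ e X u∈ ; v∈e , v∈∁X = x∈p∩q⁻ e (∁ X) v∈ in
    u , v , u∈e , v∈e , u∈X , x∈∁p⇒x∉p v∈∁X

  crosses⁺ : {X e : Subset n} {u v : Fin n} → u ∈ e → v ∈ e → u ∈ X → v ∉ X → Crosses X e
  crosses⁺ u∈e v∈e u∈X v∉X = (_ , x∈p∩q⁺ (u∈e , u∈X)) , (_ , x∈p∩q⁺ (v∈e , x∉p⇒x∈∁p v∉X))

  crosses⇒splits : {X e : Subset n} → Crosses X e → Splits X e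
  crosses⇒splits c = let u , v , u∈e , v∈e , u∈X , v∉X = crosses⁻ c in
    u , v , u∈e , v∈e , λ eq → v∉X (inside⇒∈ (trans (sym eq) (∈⇒inside u∈X)))

  splits⇒crosses : {X e : Subset n} → Splits X e → Crosses X e
  splits⇒crosses {X} (u , v , u∈e , v∈e , u≢v) with u ∈? X | v ∈? X
  ... | yes u∈X | no v∉X  = crosses⁺ u∈e v∈e u∈X v∉X
  ... | no u∉X  | yes v∈X = crosses⁺ v∈e u∈e v∈X u∉X
  ... | yes u∈X | yes v∈X = contradiction (trans (∈⇒inside u∈X) (sym (∈⇒inside v∈X))) u≢v
  ... | no u∉X  | no v∉X  = contradiction (trans (∉⇒outside u∉X) (sym (∉⇒outside v∉X))) u≢v

  ∈-tabulate⁺ : ∀ {f : Fin n → Bool} {v} → f v ≡ true → v ∈ tabulateᵛ f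
  ∈-tabulate⁺ {f} {v} eq = inside⇒∈ (trans (lookup∘tabulate f v) eq)

  ∈-tabulate⁻ : ∀ {f : Fin n → Bool} {v} → v ∈ tabulateᵛ f → f v ≡ true
  ∈-tabulate⁻ {f} {v} v∈ = trans (sym (lookup∘tabulate f v)) (∈⇒inside v∈)

-- Labels of vertices with respect to a family of sets: W marks the vertices
-- in at least two sets, Z those in none, and Y i those in the i-th set only.

data Label (p : ℕ) : Set where
  W Z : Label p
  Y   : Fin p → Label p

-- The pairs of classes that make a hyperedge count twice. One orientation of `W` and `Z` is enough,
-- since `HasPair` ranges over ordered pairs.
data Opposite {p : ℕ} : Label p → Label p → Set where
  W|Z : Opposite W Z
  Y|Y : ∀ {i j} → i ≢ j → Opposite (Y i) (Y j)

module _ {p : ℕ} where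

  _≟ˡ_ : (l m : Label p) → Dec (l ≡ m)
  W ≟ˡ W = yes refl
  W ≟ˡ Z = no λ ()
  W ≟ˡ Y j = no λ ()
  Z ≟ˡ W = no λ ()
  Z ≟ˡ Z = yes refl
  Z ≟ˡ Y j = no λ ()
  Y i ≟ˡ W = no λ ()
  Y i ≟ˡ Z = no λ ()
  Y i ≟ˡ Y j with i ≟ᶠ j
  ... | yes refl = yes refl
  ... | no i≢j = no λ { refl → i≢j refl }

  opposite? : (l m : Label p) → Dec (Opposite l m)
  opposite? W W = no λ ()
  opposite? W Z = yes W|Z
  opposite? W (Y j) = no λ ()
  opposite? Z m = no λ ()
  opposite? (Y i) W = no λ ()
  opposite? (Y i) Z = no λ ()
  opposite? (Y i) (Y j) with i ≟ᶠ j
  ... | yes refl = no λ { (Y|Y i≢i) → i≢i refl }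
  ... | no i≢j = yes (Y|Y i≢j)

  opposite⇒≢ : {l m : Label p} → Opposite l m → l ≢ m
  opposite⇒≢ (Y|Y i≢i) refl = i≢i refl

  -- Update of a vertex label when one more set is put in front of the family; the Boolean is
  -- membership in that set, and older indices shift by `suc`.
  addSet : Bool → Label p → Label (suc p)
  addSet _     W     = W
  addSet true  Z     = Y zero
  addSet true  (Y _) = W
  addSet false Z     = Z
  addSet false (Y j) = Y (suc j)

  -- Marks the intersection of the new set with the old class `W`; this intersection takes over the
  -- cut value in the uncrossing step.
  core : Bool → Label p → Bool
  core true W = true
  core _    _ = false

  core⁻ : ∀ a l → core a l ≡ true → a ≡ true × l ≡ W
  core⁻ true W _ = refl , refl

  differ : {A : Set} (f : Bool → Label p → A) →
    ∀ a l b m → f a l ≢ f b m → l ≢ m ⊎ a ≢ b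
  differ f a l b m f≢ with l ≟ˡ m | a ≟ᵇ b
  ... | no l≢m   | _        = inj₁ l≢m
  ... | yes _    | no a≢b   = inj₂ a≢b
  ... | yes refl | yes refl = contradiction refl f≢

  -- The new opposite pairs are `Y zero` against an older `Y`, and a `W` that has just come from a
  -- `Y` against a remaining `Z`. In both cases the old labels and the memberships differ.
  addSet-opposite : ∀ a l b m → Opposite (addSet a l) (addSet b m) → Opposite l m ⊎ (l ≢ m × a ≢ b)
  addSet-opposite true  Z     true  Z     (Y|Y 0≢0) = contradiction refl 0≢0
  addSet-opposite true  Z     false (Y _) _         = inj₂ ((λ ()) , (λ ()))
  addSet-opposite false (Y _) true  Z     _         = inj₂ ((λ ()) , (λ ()))
  addSet-opposite false (Y _) false (Y _) (Y|Y i≢j) = inj₁ (Y|Y (i≢j ∘ cong suc))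
  addSet-opposite _     W     false (Y _) ()
  addSet-opposite _     W     true  (Y _) ()
  addSet-opposite true  (Y _) false (Y _) ()
  addSet-opposite true  (Y _) true  (Y _) ()
  addSet-opposite true  (Y _) false Z     _         = inj₂ ((λ ()) , (λ ()))
  addSet-opposite _     W     false Z     _         = inj₁ W|Z

  -- Here `c` and `x` are the membership and old label of a core vertex. A vertex not relabelled `W`
  -- was either in `Z`, hence opposite to it, or in some `Y` and outside the new set.
  addSet-≢W : ∀ {c x} → c ≡ true → x ≡ W → ∀ a l → addSet a l ≢ W → Opposite x l ⊎ (x ≢ l × c ≢ a)
  addSet-≢W refl refl true  (Y _) ≢W = contradiction refl ≢W
  addSet-≢W refl refl _     W     ≢W = contradiction refl ≢W
  addSet-≢W refl refl _     Z     ≢W = inj₁ W|Z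
  addSet-≢W refl refl false (Y _) ≢W = inj₂ ((λ ()) , (λ ()))

  addSet-opposite-W : ∀ {c x} → c ≡ true → x ≡ W → ∀ a l b m → Opposite (addSet a l) (addSet b m) →
    (Opposite x l ⊎ Opposite x m ⊎ Opposite l m) × (c ≢ a ⊎ c ≢ b)
  addSet-opposite-W refl refl true  Z     true  Z     (Y|Y 0≢0) = contradiction refl 0≢0
  addSet-opposite-W refl refl true  Z     false (Y _) _         = inj₁ W|Z , inj₂ λ ()
  addSet-opposite-W refl refl false (Y _) true  Z     _         = inj₂ (inj₁ W|Z) , inj₁ λ ()
  addSet-opposite-W refl refl false (Y _) false (Y _) (Y|Y i≢j) = inj₂ (inj₂ (Y|Y (i≢j ∘ cong suc))) , inj₁ λ ()
  addSet-opposite-W refl refl _     W     false (Y _) ()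
  addSet-opposite-W refl refl _     W     true  (Y _) ()
  addSet-opposite-W refl refl true  (Y _) false (Y _) ()
  addSet-opposite-W refl refl true  (Y _) true  (Y _) ()
  addSet-opposite-W refl refl true  (Y _) false Z     _         = inj₂ (inj₁ W|Z) , inj₂ λ ()
  addSet-opposite-W refl refl _     W     false Z     _         = inj₂ (inj₁ W|Z) , inj₂ λ ()

-- Uncrossing on a single hyperedge

module _ {n : ℕ} where

  Polychromatic : {A : Set} → (Fin n → A) → Subset n → Set
  Polychromatic c = HasPair λ u v → c u ≢ c v

  HasOpposites : {p : ℕ} → (Fin n → Label p) → Subset n → Set
  HasOpposites L = HasPair λ u v → Opposite (L u) (L v)

  polychromatic? : {k : ℕ} (c : Fin n → Fin k) (e : Subset n) → Dec (Polychromatic c e)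
  polychromatic? c = hasPair? λ u v → ¬? (c u ≟ᶠ c v)

  module _ {p : ℕ} (L : Fin n → Label p) where

    multilabelled? : ∀ e → Dec (Polychromatic L e)
    multilabelled? = hasPair? λ u v → ¬? (L u ≟ˡ L v)

    hasOpposites? : ∀ e → Dec (HasOpposites L e)
    hasOpposites? = hasPair? λ u v → opposite? (L u) (L v)

    opposites⇒multilabelled : ∀ {e} → HasOpposites L e → Polychromatic L e
    opposites⇒multilabelled (u , v , u∈e , v∈e , opp) = u , v , u∈e , v∈e , opposite⇒≢ opp

    -- Opposite `Y` classes pay for a hyperedge that both colourings charge; the extra charge for
    -- `W` against `Z` is what makes the uncrossing inequality hold.
    weight : Subset n → ℕ
    weight e = ⟦ multilabelled? e ⟧ + ⟦ hasOpposites? e ⟧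

    module _ (A : Subset n) where

      refine : Fin n → Label (suc p)
      refine v = addSet (lookup A v) (L v)

      coreOf : Subset n
      coreOf = tabulateᵛ λ v → core (lookup A v) (L v)

      differ⇒multilabelled-or-crosses : {B : Set} (f : Bool → Label p → B) → ∀ {e} →
        HasPair (λ u v → f (lookup A u) (L u) ≢ f (lookup A v) (L v)) e →
        Polychromatic L e ⊎ Crosses A e
      differ⇒multilabelled-or-crosses f (u , v , u∈e , v∈e , ≢f) with differ f (lookup A u) (L u) (lookup A v) (L v) ≢f
      ... | inj₁ ≢L = inj₁ (u , v , u∈e , v∈e , ≢L)
      ... | inj₂ ≢A = inj₂ (splits⇒crosses (u , v , u∈e , v∈e , ≢A))

      core-crosses⇒multilabelled-or-crosses : ∀ {e} → Crosses coreOf e → Polychromatic L e ⊎ Crosses A e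
      core-crosses⇒multilabelled-or-crosses c with crosses⇒splits c
      ... | u , v , u∈e , v∈e , ≢c = differ⇒multilabelled-or-crosses core (u , v , u∈e , v∈e ,
        subst₂ _≢_ (lookup∘tabulate _ u) (lookup∘tabulate _ v) ≢c)

      core-vertex : ∀ {e} → Crosses coreOf e → ∃[ x ] (x ∈ e × lookup A x ≡ true × L x ≡ W)
      core-vertex {e} ((x , x∈) , _) with x∈p∩q⁻ e coreOf x∈
      ... | x∈e , x∈C = x , x∈e , core⁻ _ _ (∈-tabulate⁻ x∈C)

      refine-opposites : ∀ {e} → HasOpposites refine e → HasOpposites L e ⊎ (Polychromatic L e × Crosses A e)
      refine-opposites (u , v , u∈e , v∈e , o) with addSet-opposite (lookup A u) (L u) (lookup A v) (L v) o
      ... | inj₁ o′        = inj₁ (u , v , u∈e , v∈e , o′)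
      ... | inj₂ (≢L , ≢A) = inj₂ ((u , v , u∈e , v∈e , ≢L) , splits⇒crosses (u , v , u∈e , v∈e , ≢A))

      core-meets-non-W : ∀ {e u} → Crosses coreOf e → u ∈ e → refine u ≢ W →
        HasOpposites L e ⊎ (Polychromatic L e × Crosses A e)
      core-meets-non-W {u = u} c u∈e ≢W with core-vertex c
      ... | x , x∈e , x∈A , x∈W with addSet-≢W x∈A x∈W (lookup A u) (L u) ≢W
      ... | inj₁ o         = inj₁ (x , u , x∈e , u∈e , o)
      ... | inj₂ (≢L , ≢A) = inj₂ ((x , u , x∈e , u∈e , ≢L) , splits⇒crosses (x , u , x∈e , u∈e , ≢A))

      -- Of two different new labels one is not `W`; that vertex is compared with a core vertex of
      -- the hyperedge.
      refine-multilabelled-core : ∀ {e} → Polychromatic refine e → Crosses coreOf e →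
        HasOpposites L e ⊎ (Polychromatic L e × Crosses A e)
      refine-multilabelled-core (u , v , u∈e , v∈e , u≢v) c with refine u ≟ˡ W | refine v ≟ˡ W
      ... | no ≢W | _     = core-meets-non-W c u∈e ≢W
      ... | _     | no ≢W = core-meets-non-W c v∈e ≢W
      ... | yes p | yes q = contradiction (trans p (sym q)) u≢v

      refine-opposites-core : ∀ {e} → HasOpposites refine e → Crosses coreOf e → HasOpposites L e × Crosses A e
      refine-opposites-core {e} (u , v , u∈e , v∈e , o) c with core-vertex c
      ... | x , x∈e , x∈A , x∈W
        with addSet-opposite-W x∈A x∈W (lookup A u) (L u) (lookup A v) (L v) o
      ... | o′ , s = opposites o′ , splits⇒crosses (splitting s)
        where
        opposites : _ → HasOpposites L e
        opposites (inj₁ xu)        = x , u , x∈e , u∈e , xu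
        opposites (inj₂ (inj₁ xv)) = x , v , x∈e , v∈e , xv
        opposites (inj₂ (inj₂ uv)) = u , v , u∈e , v∈e , uv
        splitting : _ → Splits A e
        splitting (inj₁ xu) = x , u , x∈e , u∈e , xu
        splitting (inj₂ xv) = x , v , x∈e , v∈e , xv

  -- Submodularity for labellings: adding `A` trades the cut of `A` for the cut of its core, with
  -- the weight absorbing the difference.
  weight-refine : ∀ {p} (L : Fin n → Label p) A e →
    weight (refine L A) e + ⟦ crosses? (coreOf L A) e ⟧ ≤ weight L e + ⟦ crosses? A e ⟧
  weight-refine L A e = ⟦⟧-uncross (multilabelled? L e) (hasOpposites? L e) (crosses? A e)
    (opposites⇒multilabelled L)
    (multilabelled? (refine L A) e) (hasOpposites? (refine L A) e) (crosses? (coreOf L A) e)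
    (differ⇒multilabelled-or-crosses L A addSet) (core-crosses⇒multilabelled-or-crosses L A) (refine-opposites L A) (refine-multilabelled-core L A) (refine-opposites-core L A)

  labelling : {p : ℕ} → (Fin p → Subset n) → Fin n → Label p
  labelling {zero}  A = const Z
  labelling {suc p} A = refine (labelling (A ∘ suc)) (A zero)

  labelling-none : ∀ {p} (A : Fin p → Subset n) {v} → (∀ i → v ∉ A i) → labelling A v ≡ Z
  labelling-none {zero}  A v∉ = refl
  labelling-none {suc p} A v∉
    rewrite ∉⇒outside (v∉ zero) | labelling-none (A ∘ suc) (v∉ ∘ suc) = refl

  labelling-one : ∀ {p} (A : Fin p → Subset n) {v} i → v ∈ A i → (∀ j → j ≢ i → v ∉ A j) →
    labelling A v ≡ Y i
  labelling-one A zero v∈ v∉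
    rewrite ∈⇒inside v∈ | labelling-none (A ∘ suc) (λ j → v∉ (suc j) λ ()) = refl
  labelling-one A (suc i) v∈ v∉
    rewrite ∉⇒outside (v∉ zero λ ())
          | labelling-one (A ∘ suc) i v∈ (λ j j≢i → v∉ (suc j) (j≢i ∘ suc-injective)) = refl

  labelling-all : ∀ {p} → 2 ≤ p → (A : Fin p → Subset n) → ∀ {v} → (∀ i → v ∈ A i) → labelling A v ≡ W
  labelling-all {suc zero} (s≤s ())
  labelling-all {suc (suc zero)} _ A v∈ rewrite ∈⇒inside (v∈ (suc zero)) | ∈⇒inside (v∈ zero) = refl
  labelling-all {suc (suc (suc p))} _ A v∈
    rewrite labelling-all (s≤s (s≤s z≤n)) (A ∘ suc) (v∈ ∘ suc) = refl

-- Total weight of the labelling of a family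

module _ (G : Hypergraph) where
  open Hypergraph G

  totalWeight : {p : ℕ} → (Vertex → Label p) → ℕ
  totalWeight L = total (weight L) edges

  totalWeight-refine : ∀ {p} (L : Vertex → Label p) A →
    totalWeight (refine L A) + d G (coreOf L A) ≤ totalWeight L + d G A
  totalWeight-refine L A = begin
    totalWeight (refine L A) + d G (coreOf L A)
      ≡⟨ cong (totalWeight (refine L A) +_) (length-filter≡total (crosses? (coreOf L A)) edges) ⟩
    totalWeight (refine L A) + total (λ e → ⟦ crosses? (coreOf L A) e ⟧) edges
      ≡⟨ total-+ _ _ edges ⟨
    total (λ e → weight (refine L A) e + ⟦ crosses? (coreOf L A) e ⟧) edges
      ≤⟨ total-mono (weight-refine L A) edges ⟩
    total (λ e → weight L e + ⟦ crosses? A e ⟧) edges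
      ≡⟨ total-+ _ _ edges ⟩
    totalWeight L + total (λ e → ⟦ crosses? A e ⟧) edges
      ≡⟨ cong (totalWeight L +_) (length-filter≡total (crosses? A) edges) ⟨
    totalWeight L + d G A ∎
    where open ≤-Reasoning

  totalWeight-const : ∀ {p} (l : Label p) → totalWeight (const l) ≤ 0
  totalWeight-const {p} l = begin
    total (weight (const l)) edges ≤⟨ total-mono weightless edges ⟩
    total (const 0) edges          ≡⟨ total-0 edges ⟩
    0                              ∎
    where
    open ≤-Reasoning
    weightless : ∀ e → weight {order} (const l) e ≤ 0
    weightless e with multilabelled? (const l) e | hasOpposites? (const l) e
    ... | yes (_ , _ , _ , _ , l≢l) | _ = contradiction refl l≢l
    ... | no _ | yes (_ , _ , _ , _ , o) = contradiction refl (opposite⇒≢ o)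
    ... | no _ | no _ = z≤n

  totalWeight-singleton : (A : Fin 1 → VertexSet) → totalWeight (labelling A) ≤ d G (A zero)
  totalWeight-singleton A = begin
    totalWeight (labelling A)             ≤⟨ m≤m+n _ _ ⟩
    totalWeight (labelling A) + _         ≤⟨ totalWeight-refine (const Z) (A zero) ⟩
    totalWeight (const Z) + d G (A zero)  ≤⟨ +-monoˡ-≤ _ (totalWeight-const Z) ⟩
    d G (A zero)                          ∎
    where open ≤-Reasoning

  module _ (B : VertexSet) {M : ℕ} where

    -- The first two sets contribute at most `M` each. Every later set is free: its core lies
    -- between `B` and the set, so by minimality the core has at least as large a cut value, and the
    -- two cut values cancel.
    totalWeight-labelling : ∀ {p} (A : Fin p → VertexSet) →
      (∀ i → B ⊆ A i) → (∀ i C → B ⊆ C → C ⊆ A i → d G (A i) ≤ d G C) → (∀ i → d G (A i) ≤ M) →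
      totalWeight (labelling A) ≤ M + M
    totalWeight-labelling {zero} A _ _ _ = ≤-trans (totalWeight-const Z) z≤n
    totalWeight-labelling {suc zero} A _ _ dA≤M =
      ≤-trans (totalWeight-singleton A) (≤-trans (dA≤M zero) (m≤m+n M M))
    totalWeight-labelling {suc (suc zero)} A _ _ dA≤M = begin
      totalWeight (labelling A)                        ≤⟨ m≤m+n _ _ ⟩
      totalWeight (labelling A) + _                    ≤⟨ totalWeight-refine (labelling (A ∘ suc)) (A zero) ⟩
      totalWeight (labelling (A ∘ suc)) + d G (A zero)
        ≤⟨ +-mono-≤ (≤-trans (totalWeight-singleton (A ∘ suc)) (dA≤M (suc zero))) (dA≤M zero) ⟩
      M + M                                            ∎
      where open ≤-Reasoning
    totalWeight-labelling {suc (suc (suc p))} A B⊆A A-min dA≤M =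
      +-cancelʳ-≤ (d G C) _ _ (begin
        totalWeight (labelling A) + d G C             ≤⟨ totalWeight-refine (labelling (A ∘ suc)) (A zero) ⟩
        totalWeight (labelling (A ∘ suc)) + d G (A zero)
          ≤⟨ +-mono-≤ (totalWeight-labelling (A ∘ suc) (B⊆A ∘ suc) (A-min ∘ suc) (dA≤M ∘ suc))
                      (A-min zero C B⊆C C⊆A) ⟩
        M + M + d G C                                 ∎)
      where
      open ≤-Reasoning
      C : VertexSet
      C = coreOf (labelling (A ∘ suc)) (A zero)
      B⊆C : B ⊆ C
      -- `B` lies in all earlier sets, and there are at least two of them, so its old label is `W`.
      B⊆C v∈B = ∈-tabulate⁺ (cong₂ core (∈⇒inside (B⊆A zero v∈B))
        (labelling-all (s≤s (s≤s z≤n)) (A ∘ suc) (λ i → B⊆A (suc i) v∈B)))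
      C⊆A : C ⊆ A zero
      C⊆A v∈C = inside⇒∈ (proj₁ (core⁻ _ _ (∈-tabulate⁻ v∈C)))

-- Each half of the 2q classes Y i gives a (q+1)-colouring; since a hyperedge with
-- only one class Y i is charged to only one of them, the two costs together are
-- at most the total weight.

module _ {q : ℕ} where

  halfˡ halfʳ : Label (q + q) → Fin (suc q)
  halfˡ (Y i) = [ inject₁ , const (fromℕ q) ]′ (splitAt q i)
  halfˡ _     = fromℕ q
  halfʳ (Y i) = [ const (fromℕ q) , inject₁ ]′ (splitAt q i)
  halfʳ _     = fromℕ q

  halfˡ-inject₁ : ∀ i → halfˡ (Y (i ↑ˡ q)) ≡ inject₁ i
  halfˡ-inject₁ i rewrite splitAt-↑ˡ q i q = refl

  halfʳ-inject₁ : ∀ i → halfʳ (Y (q ↑ʳ i)) ≡ inject₁ i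
  halfʳ-inject₁ i rewrite splitAt-↑ʳ q q i = refl

  halfˡ-≢last : ∀ l → halfˡ l ≢ fromℕ q → ∃[ i ] l ≡ Y (i ↑ˡ q)
  halfˡ-≢last W     ≢last = contradiction refl ≢last
  halfˡ-≢last Z     ≢last = contradiction refl ≢last
  halfˡ-≢last (Y i) ≢last with splitAt q i in eq
  ... | inj₁ j = j , cong Y (sym (splitAt⁻¹-↑ˡ eq))
  ... | inj₂ j = contradiction refl ≢last

  halfʳ-≢last : ∀ l → halfʳ l ≢ fromℕ q → ∃[ i ] l ≡ Y (q ↑ʳ i)
  halfʳ-≢last W     ≢last = contradiction refl ≢last
  halfʳ-≢last Z     ≢last = contradiction refl ≢last
  halfʳ-≢last (Y i) ≢last with splitAt q i in eq
  ... | inj₁ j = contradiction refl ≢last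
  ... | inj₂ j = j , cong Y (sym (splitAt⁻¹-↑ʳ {q} eq))

  ↑ˡ≢↑ʳ : (i j : Fin q) → i ↑ˡ q ≢ q ↑ʳ j
  ↑ˡ≢↑ʳ i j eq with trans (sym (splitAt-↑ˡ q i q)) (trans (cong (splitAt q) eq) (splitAt-↑ʳ q q j))
  ... | ()

  module _ {n : ℕ} (L : Fin n → Label (q + q)) where

    polychromatic-≢ : {e : Subset n} {c : Fin n → Fin (suc q)} → Polychromatic c e →
      ∀ x → ∃[ u ] (u ∈ e × c u ≢ x)
    polychromatic-≢ {c = c} (u , v , u∈e , v∈e , u≢v) x with c u ≟ᶠ x
    ... | no u≢x  = u , u∈e , u≢x
    ... | yes u≡x = v , v∈e , λ v≡x → u≢v (trans u≡x (sym v≡x))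

    -- A non-constant colouring of the hyperedge gives a vertex off the last colour, that is, in a
    -- `Y` class of the half in question. The two halves have disjoint index ranges.
    halves-opposite : ∀ {e} → Polychromatic (halfˡ ∘ L) e → Polychromatic (halfʳ ∘ L) e → HasOpposites L e
    halves-opposite pˡ pʳ with polychromatic-≢ pˡ (fromℕ q) | polychromatic-≢ pʳ (fromℕ q)
    ... | u , u∈e , u≢ | v , v∈e , v≢ with halfˡ-≢last (L u) u≢ | halfʳ-≢last (L v) v≢
    ... | i , Lu | j , Lv = u , v , u∈e , v∈e , subst₂ Opposite (sym Lu) (sym Lv) (Y|Y (↑ˡ≢↑ʳ i j))

    halves-weight : ∀ e → ⟦ polychromatic? (halfˡ ∘ L) e ⟧ + ⟦ polychromatic? (halfʳ ∘ L) e ⟧ ≤ weight L e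
    halves-weight e = ⟦⟧-+-mono (polychromatic? (halfˡ ∘ L) e) (polychromatic? (halfʳ ∘ L) e)
      (multilabelled? L e) (hasOpposites? L e)
      (inj₁ ∘ coarsen halfˡ) (inj₁ ∘ coarsen halfʳ)
      (λ pˡ pʳ → coarsen halfˡ pˡ , halves-opposite pˡ pʳ)
      where
      coarsen : (h : Label (q + q) → Fin (suc q)) → Polychromatic (h ∘ L) e → Polychromatic L e
      coarsen h (u , v , u∈e , v∈e , ≢h) = u , v , u∈e , v∈e , ≢h ∘ cong h

-- Extremal sets

module _ {n : ℕ} {Q : Subset n → Set} (Q? : Decidable Q) (f : Subset n → ℕ) where

  minimiser : ∃ Q → ∃[ A ] (Q A × ∀ C → Q C → f A ≤ f C)
  minimiser (A , QA) = descend (f A) A QA ≤-refl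
    where
    -- The bound `m` on the current value is the fuel: each improvement lowers it by one.
    descend : ∀ m A → Q A → f A ≤ m → ∃[ A ] (Q A × ∀ C → Q C → f A ≤ f C)
    descend m A QA fA≤m with anySubset? (λ C → Q? C ×-dec f C <? f A)
    ... | no ¬smaller = A , QA , λ C QC → ≮⇒≥ λ fC<fA → ¬smaller (C , QC , fC<fA)
    descend zero    A QA fA≤m | yes (C , QC , fC<fA) = contradiction (<-≤-trans fC<fA fA≤m) λ ()
    descend (suc m) A QA fA≤m | yes (C , QC , fC<fA) = descend m C QC (s≤s⁻¹ (<-≤-trans fC<fA fA≤m))

enumerate : ∀ {n m} (S : Subset n) → m ≤ ∣ S ∣ →
  Σ (Fin m → Fin n) λ f → (∀ i → f i ∈ S) × (∀ i j → f i ≡ f j → i ≡ j)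
enumerate {m = zero}  S             _       = (λ ()) , (λ ()) , λ ()
enumerate {m = suc m} (outside ∷ S) m≤S     with enumerate S m≤S
... | f , f∈S , f-inj = suc ∘ f , there ∘ f∈S , λ i j eq → f-inj i j (suc-injective eq)
enumerate {m = suc m} (inside ∷ S) (s≤s m≤S) with enumerate S m≤S
... | f , f∈S , f-inj = g , g∈S , g-inj
  where
  g : Fin (suc m) → Fin _
  g zero    = zero
  g (suc i) = suc (f i)
  g∈S : ∀ i → g i ∈ inside ∷ S
  g∈S zero    = here
  g∈S (suc i) = there (f∈S i)
  g-inj : ∀ i j → g i ≡ g j → i ≡ j
  g-inj zero    zero    _  = refl
  g-inj (suc i) (suc j) eq = cong suc (f-inj i j (suc-injective eq))

x∉p-x : ∀ {n} {p : Subset n} {x} → x ∉ p - x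
x∉p-x {p = _ ∷ p} {zero}  ()
x∉p-x {p = _ ∷ p} {suc x} (there x∈) = x∉p-x x∈

∣p∪q∣≤∣p∣+∣q∣ : ∀ {n} (p q : Subset n) → ∣ p ∪ q ∣ ≤ ∣ p ∣ + ∣ q ∣
∣p∪q∣≤∣p∣+∣q∣ []            []            = z≤n
∣p∪q∣≤∣p∣+∣q∣ (outside ∷ p) (outside ∷ q) = ∣p∪q∣≤∣p∣+∣q∣ p q
∣p∪q∣≤∣p∣+∣q∣ (outside ∷ p) (inside ∷ q)  =
  ≤-trans (s≤s (∣p∪q∣≤∣p∣+∣q∣ p q)) (≤-reflexive (sym (+-suc ∣ p ∣ ∣ q ∣)))
∣p∪q∣≤∣p∣+∣q∣ (inside ∷ p)  (outside ∷ q) = s≤s (∣p∪q∣≤∣p∣+∣q∣ p q)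
∣p∪q∣≤∣p∣+∣q∣ (inside ∷ p)  (inside ∷ q)  =
  s≤s (≤-trans (∣p∪q∣≤∣p∣+∣q∣ p q) (+-monoʳ-≤ ∣ p ∣ (n≤1+n ∣ q ∣)))

-- Uncrossing and transversals

module _ (G : Hypergraph) where
  open Hypergraph G

  colourCost : {k : ℕ} → (Vertex → Fin k) → ℕ
  colourCost c = total (λ e → ⟦ polychromatic? c e ⟧) edges

  -- A partition into `q + 1` non-empty parts, encoded by its colour function, with `B` and `r`
  -- inside the last part.
  record CheapColouring (q : ℕ) (B : VertexSet) (r : Vertex) (N : ℕ) : Set where
    field
      colour     : Vertex → Fin (suc q)
      surjective : ∀ i → ∃[ v ] colour v ≡ i
      last-on-B  : ∀ {v} → v ∈ B → colour v ≡ fromℕ q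
      last-on-r  : colour r ≡ fromℕ q
      cheap      : colourCost colour < N

  module _ {q : ℕ} (2≤2q : 2 ≤ q + q) {B : VertexSet} {r : Vertex} where

    module Colouring (A : Fin (q + q) → VertexSet) (u : Fin (q + q) → Vertex)
      (B⊆A : ∀ i → B ⊆ A i) (r∉A : ∀ i → r ∉ A i)
      (u∈A : ∀ i → u i ∈ A i) (u∉A : ∀ i j → j ≢ i → u i ∉ A j) where

      -- The private vertex `u (pick j)` has label `Y (pick j)` and so witnesses colour `inject₁ j`;
      -- `r` has label `Z` and witnesses the last colour.
      colouring : ∀ {N} (h : Label (q + q) → Fin (suc q)) → h W ≡ fromℕ q → h Z ≡ fromℕ q →
        (pick : Fin q → Fin (q + q)) → (∀ j → h (Y (pick j)) ≡ inject₁ j) →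
        colourCost (h ∘ labelling A) < N → CheapColouring q B r N
      colouring h hW hZ pick h-pick h-cheap = record
        { colour     = h ∘ labelling A
        ; surjective = onto
        ; last-on-B  = λ v∈B → trans (cong h (labelling-all 2≤2q A (λ i → B⊆A i v∈B))) hW
        ; last-on-r  = r-last
        ; cheap      = h-cheap
        }
        where
        r-last : h (labelling A r) ≡ fromℕ q
        r-last = trans (cong h (labelling-none A r∉A)) hZ
        onto : ∀ i → ∃[ v ] h (labelling A v) ≡ i
        onto i with view i
        ... | ‵fromℕ     = r , r-last
        ... | ‵inject₁ j = u (pick j) ,
          trans (cong h (labelling-one A (pick j) (u∈A (pick j)) (u∉A (pick j)))) (h-pick j)

    -- The two half colourings together cost at most twice `N - 1`, so one of them costs at most
    -- `N - 1`.
    uncross : ∀ {N} (A : Fin (q + q) → VertexSet) (u : Fin (q + q) → Vertex) →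
      (∀ i → B ⊆ A i) → (∀ i C → B ⊆ C → C ⊆ A i → d G (A i) ≤ d G C) → (∀ i → d G (A i) < N) →
      (∀ i → r ∉ A i) → (∀ i → u i ∈ A i) → (∀ i j → j ≢ i → u i ∉ A j) →
      CheapColouring q B r N
    -- The family is non-empty, so no bound `N = 0` can hold.
    uncross {zero} A u _ _ dA<0 _ _ _ =
      contradiction (dA<0 (fromℕ< (≤-trans (s≤s z≤n) 2≤2q))) λ ()
    uncross {suc M} A u B⊆A A-min dA<1+M r∉A u∈A u∉A
      with colourCost (halfˡ ∘ labelling A) ≤? M | colourCost (halfʳ ∘ labelling A) ≤? M
    ... | yes l≤M | _       = colouring halfˡ refl refl (_↑ˡ q) halfˡ-inject₁ (s≤s l≤M)
      where open Colouring A u B⊆A r∉A u∈A u∉A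
    ... | no _    | yes r≤M = colouring halfʳ refl refl (q ↑ʳ_) halfʳ-inject₁ (s≤s r≤M)
      where open Colouring A u B⊆A r∉A u∈A u∉A
    ... | no l≰M  | no r≰M  = contradiction both (<⇒≱ (+-mono-< (≰⇒> l≰M) (≰⇒> r≰M)))
      where
      open ≤-Reasoning
      both : colourCost (halfˡ ∘ labelling A) + colourCost (halfʳ ∘ labelling A) ≤ M + M
      both = begin
        colourCost (halfˡ ∘ labelling A) + colourCost (halfʳ ∘ labelling A)
          ≡⟨ total-+ _ _ edges ⟨
        total _ edges
          ≤⟨ total-mono (halves-weight (labelling A)) edges ⟩
        totalWeight G (labelling A)
          ≤⟨ totalWeight-labelling G B A B⊆A A-min (s≤s⁻¹ ∘ dA<1+M) ⟩
        M + M ∎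

    module _ {N : ℕ} (N≤1+dB : N ≤ suc (d G B)) where

      Avoiding : VertexSet → VertexSet → Set
      Avoiding S A = B ⊂ A × r ∉ A × Empty (S ∩ A)

      avoiding? : ∀ S A → Dec (Avoiding S A)
      avoiding? S A = B ⊂? A ×-dec (¬? (r ∈? A) ×-dec ¬? (nonempty? (S ∩ A)))

      LightAvoiding : VertexSet → Set
      LightAvoiding S = ∃[ A ] (Avoiding S A × d G A < N)

      lightAvoiding? : ∀ S → Dec (LightAvoiding S)
      lightAvoiding? S = anySubset? λ A → avoiding? S A ×-dec d G A <? N

      Transversal : VertexSet → Set
      Transversal S = S ⊆ ∁ B × r ∉ S × ¬ LightAvoiding S

      transversal? : ∀ S → Dec (Transversal S)
      transversal? S = S ⊆? ∁ B ×-dec (¬? (r ∈? S) ×-dec ¬? (lightAvoiding? S))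

      -- A set strictly above `B` that avoids `r` has a vertex outside `B` other than `r`. This
      -- provides the starting point for choosing a smallest transversal.
      all-transversal : Transversal (∁ B - r)
      all-transversal = p─q⊆p (∁ B) ⁅ r ⁆ , x∉p-x {p = ∁ B} ,
        λ { (A , ((B⊆A , x , x∈A , x∉B) , r∉A , empty) , _) →
            empty (x , x∈p∩q⁺ (x∈p∧x≢y⇒x∈p-y (x∉p⇒x∈∁p x∉B) (λ { refl → r∉A x∈A }) , x∈A)) }

      module _ (S : VertexSet) (S-trans : Transversal S)
               (S-min : ∀ S′ → Transversal S′ → ∣ S ∣ ≤ ∣ S′ ∣) where

        private
          S⊆∁B : S ⊆ ∁ B
          S⊆∁B = proj₁ S-trans

        -- By minimality of the size of `S`, removing `u` leaves some light set unmet. Such a set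
        -- must contain `u`, or else `S` itself would fail to meet it.
        privateCut : ∀ {u} → u ∈ S →
          ∃[ A ] (Avoiding (S - u) A × u ∈ A × d G A < N × (∀ C → B ⊆ C → C ⊆ A → d G A ≤ d G C))
        privateCut {u} u∈S with lightAvoiding? (S - u)
        ... | no ¬light = contradiction (S-min (S - u)
                ((λ v∈ → S⊆∁B (p─q⊆p S ⁅ u ⁆ v∈)) , (λ r∈ → proj₁ (proj₂ S-trans) (p─q⊆p S ⁅ u ⁆ r∈)) , ¬light))
                (<⇒≱ (x∈p⇒∣p-x∣<∣p∣ u∈S))
        -- The minimum is taken over all sets avoiding `S - u`, light or not: the minimiser inherits
        -- lightness from `A₀` and can be compared with every set between `B` and itself.
        ... | yes (A₀ , avoid₀ , dA₀<N) with minimiser (avoiding? (S - u)) (d G) (A₀ , avoid₀)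
        ... | A , avoid@(B⊂A , r∉A , empty) , A-min = A , avoid , u∈A , dA<N , downward
          where
          dA<N : d G A < N
          dA<N = ≤-<-trans (A-min A₀ avoid₀) dA₀<N

          u∈A : u ∈ A
          u∈A = decidable-stable (u ∈? A) λ u∉A → proj₂ (proj₂ S-trans)
            (A , (B⊂A , r∉A , λ { (x , x∈) → let x∈S , x∈A = x∈p∩q⁻ S A x∈ in
              empty (x , x∈p∩q⁺ (x∈p∧x≢y⇒x∈p-y x∈S (λ { refl → u∉A x∈A }) , x∈A)) }) , dA<N)

          downward : ∀ C → B ⊆ C → C ⊆ A → d G A ≤ d G C
          downward C B⊆C C⊆A with B ⊂? C
          ... | yes B⊂C = A-min C (B⊂C , r∉A ∘ C⊆A , λ { (x , x∈) →
                  let x∈S , x∈C = x∈p∩q⁻ (S - u) C x∈ in empty (x , x∈p∩q⁺ (x∈S , C⊆A x∈C)) })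
          -- Here `C` equals `B`, and `d A < N ≤ d B + 1` gives the bound.
          ... | no B⊄C = subst (λ D → d G A ≤ d G D) (⊆-antisym B⊆C C⊆B) (s≤s⁻¹ (≤-trans dA<N N≤1+dB))
            where
            C⊆B : C ⊆ B
            C⊆B {x} x∈C = decidable-stable (x ∈? B) λ x∉B → B⊄C (B⊆C , x , x∈C , x∉B)

        -- The cut chosen for one element of `S` misses all the others, so the enumerated elements
        -- are private to their cuts.
        large⇒cheap : q + q ≤ ∣ S ∣ → CheapColouring q B r N
        large⇒cheap 2q≤S with enumerate S 2q≤S
        ... | f , f∈S , f-inj = uncross (proj₁ ∘ cut) f
          (λ i → let _ , ((B⊆A , _) , _) , _ = cut i in B⊆A)
          (λ i → let _ , _ , _ , _ , A-min = cut i in A-min)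
          (λ i → let _ , _ , _ , dA<N , _ = cut i in dA<N)
          (λ i → let _ , (_ , r∉A , _) , _ = cut i in r∉A)
          (λ i → let _ , _ , u∈A , _ = cut i in u∈A)
          (λ i j j≢i fi∈A → let _ , (_ , _ , empty) , _ = cut j in
            empty (f i , x∈p∩q⁺ (x∈p∧x≢y⇒x∈p-y (f∈S i) (j≢i ∘ sym ∘ f-inj i j) , fi∈A)))
          where
          cut = λ i → privateCut (f∈S i)

      cheap-or-transversal : CheapColouring q B r N ⊎ (∃[ S ] (Transversal S × ∣ S ∣ < q + q))
      cheap-or-transversal with minimiser transversal? ∣_∣ (∁ B - r , all-transversal)
      ... | S , S-trans , S-min with ∣ S ∣ <? q + q
      ... | yes small = inj₂ (S , S-trans , small)
      ... | no large  = inj₁ (large⇒cheap S S-trans S-min (≮⇒≥ large))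

-- Cut functions and partitions

module _ {n : ℕ} where

  parts : {k : ℕ} → (Fin n → Fin k) → Fin k → Subset n
  parts c i = tabulateᵛ λ v → does (c v ≟ᶠ i)

  ∈-parts⁺ : ∀ {k} (c : Fin n → Fin k) {v i} → c v ≡ i → v ∈ parts c i
  ∈-parts⁺ c {v} {i} eq = ∈-tabulate⁺ (dec-true (c v ≟ᶠ i) eq)

  ∈-parts⁻ : ∀ {k} (c : Fin n → Fin k) {v i} → v ∈ parts c i → c v ≡ i
  ∈-parts⁻ c {v} {i} v∈ with c v ≟ᶠ i | ∈-tabulate⁻ {f = λ v → does (c v ≟ᶠ i)} v∈
  ... | yes eq | _ = eq

  parts-isPartition : ∀ {k} {c : Fin n → Fin k} → (∀ i → ∃[ v ] c v ≡ i) → IsPartition (parts c)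
  parts-isPartition {c = c} onto = record
    { nonempty = λ i → let v , eq = onto i in v , ∈-parts⁺ c eq
    ; disjoint = λ i j i≢j → λ { (v , v∈) → let v∈i , v∈j = x∈p∩q⁻ (parts c i) (parts c j) v∈ in
        i≢j (trans (sym (∈-parts⁻ c v∈i)) (∈-parts⁻ c v∈j)) }
    ; covers   = λ v → c v , ∈-parts⁺ c refl
    }

  meetsTwoParts⇒polychromatic : ∀ {k} {c : Fin n → Fin k} {e} → MeetsTwoParts (parts c) e → Polychromatic c e
  meetsTwoParts⇒polychromatic {c = c} {e} (i , j , i≢j , (u , u∈) , (v , v∈))
    with x∈p∩q⁻ e (parts c i) u∈ | x∈p∩q⁻ e (parts c j) v∈
  ... | u∈e , u∈i | v∈e , v∈j = u , v , u∈e , v∈e ,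
    λ eq → i≢j (trans (sym (∈-parts⁻ c u∈i)) (trans eq (∈-parts⁻ c v∈j)))

  ∈-⋃-take⁺ : ∀ {k} m (P : Fin k → Subset n) {i v} → toℕ i < m → v ∈ P i → v ∈ ⋃ (take m (tabulate P))
  ∈-⋃-take⁺ (suc m) P {zero}  _         v∈ = x∈p∪q⁺ (inj₁ v∈)
  ∈-⋃-take⁺ (suc m) P {suc i} (s≤s i<m) v∈ = x∈p∪q⁺ (inj₂ (∈-⋃-take⁺ m (P ∘ suc) i<m v∈))

  ∈-⋃-take⁻ : ∀ {k} m (P : Fin k → Subset n) {v} → v ∈ ⋃ (take m (tabulate P)) → ∃[ i ] (toℕ i < m × v ∈ P i)
  ∈-⋃-take⁻         zero    P v∈ = contradiction v∈ ∉⊥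
  ∈-⋃-take⁻ {zero}  (suc m) P v∈ = contradiction v∈ ∉⊥
  ∈-⋃-take⁻ {suc k} (suc m) P v∈ with x∈p∪q⁻ (P zero) _ v∈
  ... | inj₁ v∈P₀ = zero , s≤s z≤n , v∈P₀
  ... | inj₂ v∈⋃  with ∈-⋃-take⁻ m (P ∘ suc) v∈⋃
  ... | i , i<m , v∈Pᵢ = suc i , s≤s i<m , v∈Pᵢ

module _ (G : Hypergraph) where
  open Hypergraph G

  count-mono : {P Q : VertexSet → Set} (P? : Decidable P) (Q? : Decidable Q) → (∀ {e} → P e → Q e) →
    length (filter P? edges) ≤ length (filter Q? edges)
  count-mono P? Q? P⇒Q = subst₂ _≤_
    (sym (length-filter≡total P? edges)) (sym (length-filter≡total Q? edges))
    (total-mono (λ e → ⟦⟧-mono (P? e) (Q? e) P⇒Q) edges)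

  cost-parts : ∀ {k} (c : Vertex → Fin k) → cost G (parts c) ≤ colourCost G c
  cost-parts c = ≤-trans
    (count-mono (meetsTwoParts? (parts c)) (polychromatic? c) meetsTwoParts⇒polychromatic)
    (≤-reflexive (length-filter≡total (polychromatic? c) edges))

  d≤d∁ : ∀ X → d G X ≤ d G (∁ X)
  d≤d∁ X = count-mono (crosses? X) (crosses? (∁ X)) λ c →
    let u , v , u∈e , v∈e , u∈X , v∉X = crosses⁻ c in
    crosses⁺ v∈e u∈e (x∉p⇒x∈∁p v∉X) (x∈p⇒x∉∁p u∈X)

  d∁≤d : ∀ X → d G (∁ X) ≤ d G X
  d∁≤d X = count-mono (crosses? (∁ X)) (crosses? X) λ c →
    let u , v , u∈e , v∈e , u∈∁X , v∉∁X = crosses⁻ c in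
    crosses⁺ v∈e u∈e (x∉∁p⇒x∈p v∉∁X) (x∈∁p⇒x∉p u∈∁X)

  d-submodular : ∀ X U → d G (X ∩ U) + d G (X ∪ U) ≤ d G X + d G U
  d-submodular X U = begin
    d G (X ∩ U) + d G (X ∪ U)
      ≡⟨ cong₂ _+_ (length-filter≡total (crosses? (X ∩ U)) edges) (length-filter≡total (crosses? (X ∪ U)) edges) ⟩
    total (λ e → ⟦ crosses? (X ∩ U) e ⟧) edges + total (λ e → ⟦ crosses? (X ∪ U) e ⟧) edges
      ≡⟨ total-+ _ _ edges ⟨
    total (λ e → ⟦ crosses? (X ∩ U) e ⟧ + ⟦ crosses? (X ∪ U) e ⟧) edges
      ≤⟨ total-mono (λ e → ⟦⟧-+-mono (crosses? (X ∩ U) e) (crosses? (X ∪ U) e) (crosses? X e) (crosses? U e)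
           meet join both) edges ⟩
    total (λ e → ⟦ crosses? X e ⟧ + ⟦ crosses? U e ⟧) edges
      ≡⟨ total-+ _ _ edges ⟩
    total (λ e → ⟦ crosses? X e ⟧) edges + total (λ e → ⟦ crosses? U e ⟧) edges
      ≡⟨ cong₂ _+_ (length-filter≡total (crosses? X) edges) (length-filter≡total (crosses? U) edges) ⟨
    d G X + d G U ∎
    where
    open ≤-Reasoning

    meet : ∀ {e} → Crosses (X ∩ U) e → Crosses X e ⊎ Crosses U e
    meet c with crosses⁻ c
    ... | u , v , u∈e , v∈e , u∈∩ , v∉∩ with x∈p∩q⁻ X U u∈∩ | v ∈? X
    ... | u∈X , u∈U | no v∉X  = inj₁ (crosses⁺ u∈e v∈e u∈X v∉X)
    ... | u∈X , u∈U | yes v∈X = inj₂ (crosses⁺ u∈e v∈e u∈U λ v∈U → v∉∩ (x∈p∩q⁺ (v∈X , v∈U)))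

    join : ∀ {e} → Crosses (X ∪ U) e → Crosses X e ⊎ Crosses U e
    join c with crosses⁻ c
    ... | u , v , u∈e , v∈e , u∈∪ , v∉∪ with x∈p∪q⁻ X U u∈∪
    ... | inj₁ u∈X = inj₁ (crosses⁺ u∈e v∈e u∈X (v∉∪ ∘ x∈p∪q⁺ ∘ inj₁))
    ... | inj₂ u∈U = inj₂ (crosses⁺ u∈e v∈e u∈U (v∉∪ ∘ x∈p∪q⁺ ∘ inj₂))

    both : ∀ {e} → Crosses (X ∩ U) e → Crosses (X ∪ U) e → Crosses X e × Crosses U e
    both c∩ c∪ with crosses⁻ c∩ | crosses⁻ c∪
    ... | u , _ , u∈e , _ , u∈∩ , _ | _ , v , _ , v∈e , _ , v∉∪ =
      let u∈X , u∈U = x∈p∩q⁻ X U u∈∩ in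
      crosses⁺ u∈e v∈e u∈X (v∉∪ ∘ x∈p∪q⁺ ∘ inj₁) , crosses⁺ u∈e v∈e u∈U (v∉∪ ∘ x∈p∪q⁺ ∘ inj₂)

  d-split≤cost : ∀ {k} m {P : Fin k → VertexSet} → IsPartition P →
    d G (⋃ (take m (tabulate P))) ≤ cost G P
  d-split≤cost m {P} isPartition =
    count-mono (crosses? U) (meetsTwoParts? P) λ c →
      let u , v , u∈e , v∈e , u∈U , v∉U = crosses⁻ c
          i , i<m , u∈Pᵢ = ∈-⋃-take⁻ m P u∈U ; j , v∈Pⱼ = covers v in
      i , j , (λ i≡j → v∉U (∈-⋃-take⁺ m P i<m (subst (λ l → v ∈ P l) (sym i≡j) v∈Pⱼ))) ,
      (u , x∈p∩q⁺ (u∈e , u∈Pᵢ)) , (v , x∈p∩q⁺ (v∈e , v∈Pⱼ))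
    where
    open IsPartition isPartition
    U : VertexSet
    U = ⋃ (take m (tabulate P))

  -- For a terminal cut `C`, submodularity and `outer` on `C ∪ U` give `d (C ∩ U) ≤ d C`. If `C`
  -- does not contain `U`, then `inner` makes `C ∩ U`, hence `C`, heavier than `U`. So `U` is the
  -- least minimum cut.
  sourceMinimal : ∀ {U S T} → S ⊆ U → T ⊆ ∁ U → Nonempty S → Nonempty T →
    (∀ X → S ⊆ X → X ⊂ U → d G U < d G X) → (∀ X → U ⊆ X → X ⊆ ∁ T → d G U ≤ d G X) →
    IsSourceMinimalMinimumTerminalCut G S T U
  sourceMinimal {U} {S} {T} S⊆U T⊆∁U (s , s∈S) (t , t∈T) inner outer = record
    { isInclusionMinimal = record
      { isMinimum = isMinimum
      ; minimal   = λ { (C , minC , (_ , x , x∈U , x∉C)) → x∉C (⊆-of-minimum minC x∈U) }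
      }
    ; unique = λ C minC → let module C = IsInclusionMinimalMinimumTerminalCut minC
                              U⊆C = ⊆-of-minimum C.isMinimum in
        sym (⊆-antisym U⊆C λ {y} y∈C → decidable-stable (y ∈? U) λ y∉U →
          C.minimal (U , isMinimum , U⊆C , y , y∈C , y∉U))
    }
    where
    isCut : IsTerminalCut G S T U
    isCut = record
      { is2Partition = (s , S⊆U s∈S) , (t , T⊆∁U t∈T)
      ; source       = S⊆U
      ; sink         = λ x∈U → x∉p⇒x∈∁p λ x∈T → x∈∁p⇒x∉p (T⊆∁U x∈T) x∈U
      }

    outer-∪ : ∀ C → IsTerminalCut G S T C → d G U ≤ d G (C ∪ U)
    outer-∪ C cutC = outer (C ∪ U) (q⊆p∪q C U) λ x∈ →
      [ IsTerminalCut.sink cutC , IsTerminalCut.sink isCut ]′ (x∈p∪q⁻ C U x∈)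

    d∩≤d : ∀ C → IsTerminalCut G S T C → d G (C ∩ U) ≤ d G C
    d∩≤d C cutC = +-cancelʳ-≤ (d G U) _ _
      (≤-trans (+-monoʳ-≤ (d G (C ∩ U)) (outer-∪ C cutC)) (d-submodular C U))

    inside-or-heavy : ∀ C → IsTerminalCut G S T C → U ⊆ C ⊎ d G U < d G C
    inside-or-heavy C cutC with U ⊆? C
    ... | yes U⊆C = inj₁ U⊆C
    ... | no U⊈C with (C ∩ U) ⊂? U
    ... | yes ⊂U = inj₂ (<-≤-trans
      (inner (C ∩ U) (λ x∈S → x∈p∩q⁺ (IsTerminalCut.source cutC x∈S , S⊆U x∈S)) ⊂U) (d∩≤d C cutC))
    ... | no ⊄U = contradiction (λ {x} x∈U → decidable-stable (x ∈? C) λ x∉C →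
      ⊄U (p∩q⊆q C U , x , x∈U , x∉C ∘ proj₁ ∘ x∈p∩q⁻ C U)) U⊈C

    isMinimum : IsMinimumTerminalCut G S T U
    isMinimum = record { isTerminalCut = isCut ; minimum = lower }
      where
      lower : ∀ C → IsTerminalCut G S T C → d G U ≤ d G C
      lower C cutC with inside-or-heavy C cutC
      ... | inj₁ U⊆C = outer C U⊆C (IsTerminalCut.sink cutC)
      ... | inj₂ dU<dC = <⇒≤ dU<dC

    ⊆-of-minimum : ∀ {C} → IsMinimumTerminalCut G S T C → U ⊆ C
    ⊆-of-minimum {C} minC with inside-or-heavy C (IsMinimumTerminalCut.isTerminalCut minC)
    ... | inj₁ U⊆C = U⊆C
    ... | inj₂ dU<dC = contradiction (IsMinimumTerminalCut.minimum minC U isCut) (<⇒≱ dU<dC)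

  -- Cheap colourings against a minimal balanced split, with `k = q + 2`

  module _ {q : ℕ} {U : VertexSet} (split : IsMinimalBalancedSplit G (suc (suc q)) U) where
    open IsMinimalBalancedSplit split
    open IsBalancedSplit isBalancedSplit renaming (parts to P; isMinimum to P-minimum)

    private
      k : ℕ
      k = suc (suc q)

    d≤cost : d G U ≤ cost G P
    d≤cost = subst (λ X → d G X ≤ cost G P) (sym union)
      (d-split≤cost ⌊ k /2⌋ (IsMinimumPartition.isPartition P-minimum))

    d≤colourCost : (c : Vertex → Fin k) → (∀ i → ∃[ v ] c v ≡ i) → d G U ≤ colourCost G c
    d≤colourCost c onto = begin
      d G U              ≤⟨ d≤cost ⟩
      cost G P           ≤⟨ IsMinimumPartition.minimum P-minimum (parts c) (parts-isPartition onto) ⟩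
      cost G (parts c)   ≤⟨ cost-parts c ⟩
      colourCost G c     ∎
      where open ≤-Reasoning

    -- The colouring costs at most `d U`, which is at most the minimum cost, so its classes form a
    -- minimum k-partition. All classes but the last lie in `U` and miss `u`, hence the first half
    -- of them gives a strictly smaller split.
    no-colouring-inside : ∀ {u} → u ∈ U → ¬ CheapColouring G (suc q) (∁ U) u (suc (d G U))
    no-colouring-inside {u} u∈U colouring = minimal (U′ , isSplit , U′⊆U , u , u∈U , u∉U′)
      where
      open CheapColouring colouring
      h : ℕ
      h = ⌊ k /2⌋
      U′ : VertexSet
      U′ = ⋃ (take h (tabulate (parts colour)))

      last∉U′ : ∀ {v} → colour v ≡ fromℕ (suc q) → v ∉ U′
      last∉U′ eq v∈U′ with ∈-⋃-take⁻ h (parts colour) v∈U′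
      ... | i , i<h , v∈i = <⇒≱ i<h (begin
        -- Half of `k`, rounded down, is at most `k - 1`, so the last class is never among the first
        -- `h`.
        h                    ≤⟨ s≤s⁻¹ (⌊n/2⌋<n (suc q)) ⟩
        suc q                ≡⟨ toℕ-fromℕ (suc q) ⟨
        toℕ (fromℕ (suc q))  ≡⟨ cong toℕ (trans (sym eq) (∈-parts⁻ colour v∈i)) ⟩
        toℕ i                ∎)
        where open ≤-Reasoning

      u∉U′ : u ∉ U′
      u∉U′ = last∉U′ last-on-r

      U′⊆U : U′ ⊆ U
      U′⊆U v∈U′ = x∉∁p⇒x∈p λ v∈∁U → last∉U′ (last-on-B v∈∁U) v∈U′

      isSplit : IsBalancedSplit G k U′
      isSplit = record
        { is2Partition = (let v , eq = surjective zero in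
                            v , ∈-⋃-take⁺ h (parts colour) (s≤s z≤n) (∈-parts⁺ colour eq))
                       , (u , x∉p⇒x∈∁p u∉U′)
        ; parts        = parts colour
        ; isMinimum    = record
          { isPartition = parts-isPartition surjective
          ; minimum     = λ Q Q-part → begin
              cost G (parts colour) ≤⟨ cost-parts colour ⟩
              colourCost G colour   ≤⟨ s≤s⁻¹ cheap ⟩
              d G U                 ≤⟨ d≤cost ⟩
              cost G P              ≤⟨ IsMinimumPartition.minimum P-minimum Q Q-part ⟩
              cost G Q              ∎
          }
        ; union        = refl
        }
        where open ≤-Reasoning

    -- Such a colouring would be a k-partition cheaper than the minimum one, whose cost is at least
    -- `d U`.
    no-colouring-outside : ∀ {t} → ¬ CheapColouring G (suc q) U t (d G U)
    no-colouring-outside colouring = <⇒≱ cheap (d≤colourCost colour surjective)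
      where open CheapColouring colouring

    2≤2q : 2 ≤ suc q + suc q
    2≤2q = +-mono-≤ (s≤s (z≤n {q})) (s≤s z≤n)

    -- Complementation turns sets between `S ∪ {u}` and `U` into sets above `∁ U` that avoid `u` and
    -- `S`; with `N = d U + 1`, not being light means having cut value above `d U`.
    sources : ∀ {u} → u ∈ U → ∃[ S ] (S ⊆ U × u ∉ S × ∣ S ∣ < suc q + suc q ×
      (∀ X → S ⊆ X → u ∈ X → X ⊂ U → d G U < d G X))
    sources {u} u∈U
      with cheap-or-transversal G 2≤2q {B = ∁ U} {r = u} {N = suc (d G U)} (s≤s (d≤d∁ U))
    ... | inj₁ colouring = contradiction colouring (no-colouring-inside u∈U)
    ... | inj₂ (S , (S⊆∁∁U , u∉S , ¬light) , small) =
      S , x∉∁p⇒x∈p ∘ x∈∁p⇒x∉p ∘ S⊆∁∁U , u∉S , small , λ X S⊆X u∈X X⊂U →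
        ≰⇒> λ dX≤dU → ¬light (∁ X , (p⊂q⇒∁p⊃∁q X⊂U , x∈p⇒x∉∁p u∈X ,
          (λ { (x , x∈) → let x∈S , x∈∁X = x∈p∩q⁻ S (∁ X) x∈ in x∈∁p⇒x∉p x∈∁X (S⊆X x∈S) })) ,
          s≤s (≤-trans (d∁≤d X) dX≤dU))

    -- Only sets avoiding `t` are controlled here, so `t` still has to join the sink side.
    sinks : ∀ t → ∃[ T ] (T ⊆ ∁ U × ∣ T ∣ < suc q + suc q ×
      (∀ X → U ⊆ X → X ⊆ ∁ T → t ∉ X → d G U ≤ d G X))
    sinks t with cheap-or-transversal G 2≤2q {B = U} {r = t} (n≤1+n (d G U))
    ... | inj₁ colouring = contradiction colouring no-colouring-outside
    ... | inj₂ (T , (T⊆∁U , _ , ¬light) , small) = T , T⊆∁U , small , outer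
      where
      outer : ∀ X → U ⊆ X → X ⊆ ∁ T → t ∉ X → d G U ≤ d G X
      outer X U⊆X X⊆∁T t∉X with U ⊂? X
      ... | yes U⊂X = ≮⇒≥ λ dX<dU → ¬light (X , (U⊂X , t∉X ,
              (λ { (x , x∈) → let x∈T , x∈X = x∈p∩q⁻ T X x∈ in x∈∁p⇒x∉p (X⊆∁T x∈X) x∈T })) , dX<dU)
      ... | no U⊄X = ≤-reflexive (cong (d G) (⊆-antisym U⊆X λ {x} x∈X →
              decidable-stable (x ∈? U) λ x∉U → U⊄X (U⊆X , x , x∈X , x∉U)))

theorem5p3 : (G : Hypergraph) (let open Hypergraph G) (k : ℕ) → 2 ≤ k →
    (U : VertexSet) → IsMinimalBalancedSplit G k U →
    (u₀ : Vertex) → u₀ ∈ U →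
    ∃[ S ] ∃[ T ] (S ⊆ U - u₀ × T ⊆ ∁ U × ∣ S ∣ ≤ 2 * k ∸ 3 × ∣ T ∣ ≤ 2 * k ∸ 2 × IsSourceMinimalMinimumTerminalCut G (S ∪ ⁅ u₀ ⁆) T U)
theorem5p3 G (suc zero) (s≤s ())
theorem5p3 G (suc (suc q)) _ U split u₀ u₀∈U
  with IsBalancedSplit.is2Partition (IsMinimalBalancedSplit.isBalancedSplit split) | sources G split u₀∈U
... | _ , t₀ , t₀∈∁U | S , S⊆U , u₀∉S , S-small , inner with sinks G split t₀
... | T , T⊆∁U , T-small , outer =
  -- Both transversals have at most `2k - 3` elements; adding `t₀` to `T` accounts for the larger
  -- bound on the sink side and makes it non-empty.
  S , T ∪ ⁅ t₀ ⁆ , S⊆U-u₀ , T∪t₀⊆∁U , S-size , T-size ,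
  sourceMinimal G S∪u₀⊆U T∪t₀⊆∁U (u₀ , u₀∈S∪u₀) (t₀ , t₀∈T∪t₀)
    (λ X S∪u₀⊆X → inner X (S∪u₀⊆X ∘ p⊆p∪q ⁅ u₀ ⁆) (S∪u₀⊆X u₀∈S∪u₀))
    (λ X U⊆X X⊆∁ → outer X U⊆X
      (λ x∈X → x∉p⇒x∈∁p (x∈∁p⇒x∉p (X⊆∁ x∈X) ∘ p⊆p∪q ⁅ t₀ ⁆))
      (λ t₀∈X → x∈∁p⇒x∉p (X⊆∁ t₀∈X) t₀∈T∪t₀))
  where
  u₀∈S∪u₀ : u₀ ∈ S ∪ ⁅ u₀ ⁆
  u₀∈S∪u₀ = q⊆p∪q S ⁅ u₀ ⁆ (x∈⁅x⁆ u₀)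

  t₀∈T∪t₀ : t₀ ∈ T ∪ ⁅ t₀ ⁆
  t₀∈T∪t₀ = q⊆p∪q T ⁅ t₀ ⁆ (x∈⁅x⁆ t₀)

  S⊆U-u₀ : S ⊆ U - u₀
  S⊆U-u₀ x∈S = x∈p∧x≢y⇒x∈p-y (S⊆U x∈S) λ { refl → u₀∉S x∈S }

  S∪u₀⊆U : S ∪ ⁅ u₀ ⁆ ⊆ U
  S∪u₀⊆U x∈ with x∈p∪q⁻ S ⁅ u₀ ⁆ x∈
  ... | inj₁ x∈S = S⊆U x∈S
  ... | inj₂ x∈u₀ rewrite x∈⁅y⁆⇒x≡y u₀ x∈u₀ = u₀∈U

  T∪t₀⊆∁U : T ∪ ⁅ t₀ ⁆ ⊆ ∁ U
  T∪t₀⊆∁U x∈ with x∈p∪q⁻ T ⁅ t₀ ⁆ x∈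
  ... | inj₁ x∈T = T⊆∁U x∈T
  ... | inj₂ x∈t₀ rewrite x∈⁅y⁆⇒x≡y t₀ x∈t₀ = t₀∈∁U

  2k∸2 : 2 * suc (suc q) ∸ 2 ≡ suc q + suc q
  2k∸2 = trans (+-suc q _) (cong (λ m → suc (q + suc m)) (+-identityʳ q))

  S-size : ∣ S ∣ ≤ 2 * suc (suc q) ∸ 3
  S-size = subst (λ m → ∣ S ∣ ≤ m ∸ 1) (sym 2k∸2) (s≤s⁻¹ S-small)

  T-size : ∣ T ∪ ⁅ t₀ ⁆ ∣ ≤ 2 * suc (suc q) ∸ 2
  T-size = begin
    ∣ T ∪ ⁅ t₀ ⁆ ∣       ≤⟨ ∣p∪q∣≤∣p∣+∣q∣ T ⁅ t₀ ⁆ ⟩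
    ∣ T ∣ + ∣ ⁅ t₀ ⁆ ∣   ≡⟨ cong (∣ T ∣ +_) (∣⁅x⁆∣≡1 t₀) ⟩
    ∣ T ∣ + 1            ≡⟨ +-comm ∣ T ∣ 1 ⟩
    suc ∣ T ∣            ≤⟨ T-small ⟩
    suc q + suc q        ≡⟨ 2k∸2 ⟨
    2 * suc (suc q) ∸ 2  ∎
    where open ≤-Reasoning
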